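{- Let $A$ be a finite alphabet, let $X$ be a set, and let $c:X\to 2\times(\mathcal{P}\mathcal{P}X)^{A}$ be an alternating automaton, with determinization $c^{+}:\mathcal{P}X\to 2\times(\mathcal{P}\mathcal{P}X)^{A}$ (a coalgebra for the functor $M\mathcal{P}$). Then union closure $$\mathsf{Ctx}(R)=\Big\{\Big(\bigcup_{i\in I}A_i,\bigcup_{i\in I}B_i\Big)\ \Big|\ I \text{ a set},\ \forall i\in I,\ (A_i,B_i)\in R\Big\}\qquad (R\subseteq\mathcal{P}X\times\mathcal{P}X)$$ and its corresponding congruence closure $\mathsf{Cgr}$ are both $\mathsf{Rel}(M\mathcal{P})_{c^{+}}$-compatible.
   Context: $\mathcal{P}$ is the covariant powerset functor on $\mathsf{Set}$ (all subsets; direct images on functions), with monad structure given by singletons and unions $\mu^{\mathcal P}_X:\mathcal{P}\mathcal{P}X\to\mathcal{P}X$. $M:\mathsf{Set}\to\mathsf{Set}$ is the machine functor $MX=2\times X^{A}$, $Mf(o,t)=(o,f\circ t)$, with $2=\{0,1\}$. An alternating automaton (set of states $X$, labels $A$, final states $F\subseteq X$, transition relation $\to\,\subseteq X\times A\times\mathcal{P}X$) is identified with a coalgebra $c=\langle o,t\rangle:X\to M\mathcal{P}\mathcal{P}X$ where $o(x)=1$ iff $x\in F$, and $U\in t(x)(a)$ iff $(x,a,U)\in\,\to$. Define $\delta_X:\mathcal{P}\mathcal{P}X\to\mathcal{P}\mathcal{P}X$ by $\delta_X(\mathcal{A})=\{B\subseteq X\mid B\subseteq\bigcup\mathcal{A}\text{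 and }\forall A'\in\mathcal{A},\ A'\cap B\neq\emptyset\}$ and $\sigma_X:\mathcal{P}MX\to M\mathcal{P}X$ by $\sigma_X(S)=\big(\bigwedge_{(o,f)\in S}o,\ a\mapsto\{f(a)\mid(o,f)\in S\}\big)$. The determinization of $c$ (performed once) is $$c^{+}=M\mathcal{P}\mu^{\mathcal{P}}_{X}\circ M\delta_{\mathcal{P}X}\circ\sigma_{\mathcal{P}\mathcal{P}X}\circ\mathcal{P}c:\ \mathcal{P}X\to M\mathcal{P}\mathcal{P}X .$$ For a functor $F:\mathsf{Set}\to\mathsf{Set}$, an $F$-coalgebra $\xi:Y\to FY$ and $R\subseteq Y\times Y$ with projections $\pi_1,\pi_2:R\to Y$, put $\mathsf{Rel}(F)_{\xi}(R)=\{(u,v)\mid\exists t\in FR,\ (\xi(u),\xi(v))=(F\pi_1(t),F\pi_2(t))\}$. A monotone function $\mathsf{Tch}$ on $\mathcal{P}(Y\times Y)$ is $\mathsf{Rel}(F)_{\xi}$-compatible if $\mathsf{Tch}(\mathsf{Rel}(F)_{\xi}(R))\subseteq\mathsf{Rel}(F)_{\xi}(\mathsf{Tch}(R))$ for all $R$. The congruence closure is $\mathsf{Cgr}(R)=\bigcup_{n\ge0}(\mathsf{Tra}\cup\mathsf{Sym}\cup\mathsf{Ctx}\cup\mathsf{Rfl})^{n}(R)$ (pointwise unions, iterated composition), where $\mathsf{Tra}(R)=\{(x,z)\mid\exists y,\ (x,y)\in R,\ (y,z)\in R\}$, $\mathsf{Sym}(R)=\{(y,x)\mid(x,y)\in R\}$,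 $\mathsf{Rfl}(R)=\{(x,x)\mid x\in Y\}$. Here $Y=\mathcal{P}X$. -}

module Defs where

open import Axiom.ExcludedMiddle using (ExcludedMiddle)
open import Data.Bool.Base using (Bool; T; true; false)
open import Data.Nat.Base using (ℕ)
open import Data.Nat.GeneralisedArithmetic using (fold)
open import Data.Product.Base using (Σ; ∃; _×_; _,_; proj₁; proj₂; map₂)
open import Data.Sum.Base using (_⊎_)
open import Effect.Functor using (RawFunctor)
open import Function.Base using (_∘_)
open import Level using (Level)
open import Relation.Binary.PropositionalEquality using (_≡_; _≢_)
open import Relation.Nullary.Decidable using (⌊_⌋)

infix 4 _∈_ _⊆_

-- The mathematics is classical set theory: a subset is its characteristic
-- function.  Given excluded middle, this powerset is impredicative and admits
-- unrestricted comprehension; given function extensionality, `_≡_` on it is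
-- extensional equality of subsets.

𝒫 : Set → Set
𝒫 X = X → Bool

_∈_ : {X : Set} → X → 𝒫 X → Set
x ∈ U = T (U x)

_⊆_ : {X : Set} → 𝒫 X → 𝒫 X → Set
U ⊆ V = ∀ x → x ∈ U → x ∈ V

∅ : {X : Set} → 𝒫 X
∅ _ = false

El : {X : Set} → 𝒫 X → Set
El {X} U = Σ X (_∈ U)

M : Set → Set → Set
M A X = Bool × (A → X)

M-functor : (A : Set) → RawFunctor (M A)
M-functor A = record { _<$>_ = λ f → map₂ (f ∘_) }

module Classical (em : ∀ {ℓ} → ExcludedMiddle ℓ) where

  open RawFunctor using (_<$>_)

  infixr 6 _∪_ _∪̇_
  infixr 7 _∩_

  truth : {ℓ : Level} → Set ℓ → Bool
  truth P = ⌊ em {P = P} ⌋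

  -- { x ∈ X | P x }
  compr : {ℓ : Level} {X : Set} → (X → Set ℓ) → 𝒫 X
  compr P x = truth (P x)

  _∪_ : {X : Set} → 𝒫 X → 𝒫 X → 𝒫 X
  U ∪ V = compr λ x → x ∈ U ⊎ x ∈ V

  _∩_ : {X : Set} → 𝒫 X → 𝒫 X → 𝒫 X
  U ∩ V = compr λ x → x ∈ U × x ∈ V

  ⋃[_] : {X I : Set} → (I → 𝒫 X) → 𝒫 X
  ⋃[ U ] = compr λ x → ∃ λ i → x ∈ U i

  ⋃ : {X : Set} → 𝒫 (𝒫 X) → 𝒫 X
  ⋃ 𝒰 = compr λ x → ∃ λ U → U ∈ 𝒰 × x ∈ U

  image : {X Y : Set} → (X → Y) → 𝒫 X → 𝒫 Y
  image f U = compr λ y → ∃ λ x → x ∈ U × y ≡ f x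

  𝒫-functor : RawFunctor 𝒫
  𝒫-functor = record { _<$>_ = image }

  M𝒫-functor : (A : Set) → RawFunctor (M A ∘ 𝒫)
  M𝒫-functor A = record { _<$>_ = λ f → M-functor A ._<$>_ (𝒫-functor ._<$>_ f) }

  μ : (X : Set) → 𝒫 (𝒫 X) → 𝒫 X
  μ X = ⋃

  δ : (X : Set) → 𝒫 (𝒫 X) → 𝒫 (𝒫 X)
  δ X 𝒜 = compr λ B → B ⊆ ⋃ 𝒜 × (∀ A′ → A′ ∈ 𝒜 → A′ ∩ B ≢ ∅)

  σ : (A X : Set) → 𝒫 (M A X) → M A (𝒫 X)
  σ A X S = truth (∀ s → s ∈ S → proj₁ s ≡ true)
          , λ a → image (λ s → proj₂ s a) S

  determinize : {A X : Set} → (X → M A (𝒫 (𝒫 X))) → 𝒫 X → M A (𝒫 (𝒫 X))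
  determinize {A} {X} c =
    mapM (image (μ X)) ∘ mapM (δ (𝒫 X)) ∘ σ A (𝒫 (𝒫 X)) ∘ image c
    where
    mapM : {Y Z : Set} → (Y → Z) → M A Y → M A Z
    mapM = M-functor A ._<$>_

  Relation : Set → Set
  Relation Y = 𝒫 (Y × Y)

  Operator : Set → Set
  Operator Y = Relation Y → Relation Y

  Rel : {F : Set → Set} → RawFunctor F → {Y : Set} → (Y → F Y) → Operator Y
  Rel {F} 𝔽 {Y} ξ R = compr λ (u , v) →
    ∃ λ (t : F (El R)) → (ξ u , ξ v) ≡ (𝔽 ._<$>_ π₁ t , 𝔽 ._<$>_ π₂ t)
    where
    π₁ π₂ : El R → Y
    π₁ = proj₁ ∘ proj₁
    π₂ = proj₂ ∘ proj₁

  record Compatible {F : Set → Set} (𝔽 : RawFunctor F) {Y : Set} (ξ : Y → F Y)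
                    (Tch : Operator Y) : Set where
    field
      monotone   : ∀ R S → R ⊆ S → Tch R ⊆ Tch S
      compatible : ∀ R → Tch (Rel 𝔽 ξ R) ⊆ Rel 𝔽 ξ (Tch R)

  _∪̇_ : {Y : Set} → Operator Y → Operator Y → Operator Y
  (f ∪̇ g) R = f R ∪ g R

  Tra Sym Rfl : {Y : Set} → Operator Y
  Tra R = compr λ (x , z) → ∃ λ y → (x , y) ∈ R × (y , z) ∈ R
  Sym R = compr λ (y , x) → (x , y) ∈ R
  Rfl R = compr λ (x , y) → x ≡ y

  Ctx : {X : Set} → Operator (𝒫 X)
  Ctx {X} R = compr λ p →
    Σ Set λ I → Σ (I → 𝒫 X) λ U → Σ (I → 𝒫 X) λ V →
      (∀ i → (U i , V i) ∈ R) × p ≡ (⋃[ U ] , ⋃[ V ])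

  Cgr : {X : Set} → Operator (𝒫 X)
  Cgr R = ⋃[ (λ (n : ℕ) → fold R (Tra ∪̇ Sym ∪̇ Ctx ∪̇ Rfl) n) ]

{-# OPTIONS --safe #-}
-- A pair (u , v) lies in Rel (M𝒫) ξ R iff the outputs of u and v agree and, for
-- each letter, their successor sets are related by the Egli–Milner lifting of R;
-- compatibility of Tra, Sym and Rfl is immediate from this description.
-- The a-successors of S under the determinization are the unions ⋃ 𝓑 with
-- 𝓑 contained in ⋃ { t(x)(a) | x ∈ S } and meeting every t(x)(a).  For Ctx, such a
-- 𝓑 for ⋃ Uᵢ restricts to the 𝓑ᵢ = 𝓑 ∩ ⋃ { t(x)(a) | x ∈ Uᵢ }, each of which is
-- matched by some 𝓒ᵢ for Vᵢ; then ⋃ 𝓒ᵢ is admissible for ⋃ Vᵢ and ⋃ 𝓑 = ⋃ᵢ ⋃ 𝓑ᵢ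
-- is related to ⋃ᵢ ⋃ 𝓒ᵢ by Ctx R.
module Submission where

open import Defs
open import Axiom.ExcludedMiddle using (ExcludedMiddle)
open import Axiom.Extensionality.Propositional using (Extensionality)
open import Data.Bool.Base using (T; true; false)
open import Data.Bool.Properties using (T-≡)
open import Data.Empty using (⊥-elim)
open import Data.Fin.Base using (Fin)
open import Data.Nat.Base using (ℕ; zero; suc)
open import Data.Nat.GeneralisedArithmetic using (fold)
open import Data.Product.Base using (∃; ∃₂; _×_; _,_; proj₁; proj₂)
open import Data.Sum.Base using (inj₁; inj₂)
import Data.Sum.Base as Sum
open import Data.Unit.Base using (tt)
open import Effect.Functor using (RawFunctor)
open import Function.Base using (_∘_; flip)
open import Function.Bundles using (_↔_; _⇔_; mk⇔; Equivalence)
open import Level using (Level; 0ℓ)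
open import Relation.Binary.PropositionalEquality
  using (_≡_; _≢_; refl; sym; trans; cong; cong₂; subst)
open import Relation.Nullary.Decidable using (yes; no; toWitness; fromWitness)

private variable
  ℓ ℓ′ : Level
  A I X Y Z : Set

T-injective : ∀ {a b} → (T a → T b) → (T b → T a) → a ≡ b
T-injective {true}  {true}  _ _ = refl
T-injective {true}  {false} f _ = ⊥-elim (f tt)
T-injective {false} {true}  _ g = ⊥-elim (g tt)
T-injective {false} {false} _ _ = refl

Matches : (Y → Z → Set ℓ) → 𝒫 Y → 𝒫 Z → Set ℓ
Matches _~_ P Q = ∀ u → u ∈ P → ∃ λ v → v ∈ Q × u ~ v

matches-map : {_~_ : Y → Z → Set ℓ} {_≈_ : Y → Z → Set ℓ′} {P : 𝒫 Y} {Q : 𝒫 Z} →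
  (∀ {u v} → u ~ v → u ≈ v) → Matches _~_ P Q → Matches _≈_ P Q
matches-map f m u u∈P with v , v∈Q , u~v ← m u u∈P = v , v∈Q , f u~v

matches-∘ : {_~_ : X → Y → Set ℓ} {_≈_ : Y → Z → Set ℓ′} {P : 𝒫 X} {Q : 𝒫 Y} {R : 𝒫 Z} →
  Matches _~_ P Q → Matches _≈_ Q R → Matches (λ u w → ∃ λ v → u ~ v × v ≈ w) P R
matches-∘ m n u u∈P with v , v∈Q , u~v ← m u u∈P with w , w∈R , v≈w ← n v v∈Q =
  w , w∈R , v , u~v , v≈w

record EgliMilner (_~_ : Y → Y → Set ℓ) (s t : M A (𝒫 Y)) : Set ℓ where
  field
    output   : proj₁ s ≡ proj₁ t
    forward  : ∀ a → Matches _~_ (proj₂ s a) (proj₂ t a)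
    backward : ∀ a → Matches (flip _~_) (proj₂ t a) (proj₂ s a)

open EgliMilner

-- Membership in `δ` of the family of all `t x` with `x` in `S`, with nonempty intersections given
-- by witnesses. Indexing by states makes unions of state sets easy to handle.
record Admissible (t : X → 𝒫 Z) (S : 𝒫 X) (𝓑 : 𝒫 Z) : Set where
  field
    covered : ∀ b → b ∈ 𝓑 → ∃ λ x → x ∈ S × b ∈ t x
    meets   : ∀ x → x ∈ S → ∃ λ b → b ∈ t x × b ∈ 𝓑

open Admissible

module _ (em : ∀ {ℓ} → ExcludedMiddle ℓ) (ext : Extensionality 0ℓ 0ℓ) where

  open Classical em
  open RawFunctor using (_<$>_)
  open Compatible
  open Equivalence

  -- Classical truth values and extensionality of subsets.

  truth⁺ : {P : Set ℓ} → P → T (truth P)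
  truth⁺ {P = P} = fromWitness {a? = em {P = P}}

  -- Excluded middle decides arbitrary types, so a positive answer carries a definite inhabitant.
  -- Witnesses can thus be read off from Boolean membership, which amounts to a choice principle.
  truth⁻ : {P : Set ℓ} → T (truth P) → P
  truth⁻ {P = P} = toWitness {a? = em {P = P}}

  ⊆-antisym : {U V : 𝒫 X} → U ⊆ V → V ⊆ U → U ≡ V
  ⊆-antisym U⊆V V⊆U = ext λ x → T-injective (U⊆V x) (V⊆U x)

  -- Without a common element the intersection would equal `∅` by extensionality, so excluded middle
  -- yields one.
  ∩≢∅⇔ : {U V : 𝒫 X} → (U ∩ V ≢ ∅) ⇔ (∃ λ x → x ∈ U × x ∈ V)
  ∩≢∅⇔ {U = U} {V} = mk⇔ inhabited λ (x , x∈) eq → subst (x ∈_) eq (truth⁺ x∈)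
    where
    inhabited : U ∩ V ≢ ∅ → ∃ λ x → x ∈ U × x ∈ V
    inhabited ≢∅ with em {P = ∃ λ x → x ∈ U × x ∈ V}
    ... | yes x∈ = x∈
    ... | no  ∄x = ⊥-elim (≢∅ (⊆-antisym (λ x x∈ → ∄x (x , truth⁻ x∈)) (λ _ ())))

  -- Relation lifting for `M𝒫` as Egli-Milner lifting.

  [_] : Relation Y → Y → Y → Set
  [ R ] u v = (u , v) ∈ R

  module _ {ξ : Y → M A (𝒫 Y)} {R : Relation Y} {u v : Y} where

    private
      π₁ π₂ : El R → Y
      π₁ = proj₁ ∘ proj₁
      π₂ = proj₂ ∘ proj₁

      infixl 4 _⟨$⟩_
      _⟨$⟩_ : (El R → Y) → M A (𝒫 (El R)) → M A (𝒫 Y)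
      _⟨$⟩_ = M𝒫-functor A ._<$>_

    ∈Rel⁻ : (u , v) ∈ Rel (M𝒫-functor A) ξ R → EgliMilner [ R ] (ξ u) (ξ v)
    ∈Rel⁻ uv∈ with t , eq ← truth⁻ uv∈ =
      subst (λ (s , s′) → EgliMilner [ R ] s s′) (sym eq) (record
        { output   = refl
        ; forward  = λ a x x∈ → let p , p∈t , x≡ = truth⁻ x∈ in
            π₂ p , truth⁺ (p , p∈t , refl) , subst (λ x → [ R ] x (π₂ p)) (sym x≡) (proj₂ p)
        ; backward = λ a y y∈ → let p , p∈t , y≡ = truth⁻ y∈ in
            π₁ p , truth⁺ (p , p∈t , refl) , subst (λ y → [ R ] (π₁ p) y) (sym y≡) (proj₂ p)
        })

    ∈Rel⁺ : EgliMilner [ R ] (ξ u) (ξ v) → (u , v) ∈ Rel (M𝒫-functor A) ξ R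
    ∈Rel⁺ e = truth⁺
      (t , cong₂ _,_ (cong (proj₁ (ξ u) ,_) (ext π₁-image)) (cong₂ _,_ (sym (output e)) (ext π₂-image)))
      where
      -- The largest candidate: all pairs in `R` with both components among the successors.
      -- `forward` and `backward` ensure that its projections cover both successor sets.
      t : M A (𝒫 (El R))
      t = proj₁ (ξ u) , λ a → compr λ p → π₁ p ∈ proj₂ (ξ u) a × π₂ p ∈ proj₂ (ξ v) a

      π₁-image : ∀ a → proj₂ (ξ u) a ≡ proj₂ (π₁ ⟨$⟩ t) a
      π₁-image a = ⊆-antisym
        (λ x x∈ → let y , y∈ , xRy = forward e a x x∈ in
          truth⁺ (((x , y) , xRy) , truth⁺ (x∈ , y∈) , refl))
        (λ x x∈ → let p , p∈t , x≡ = truth⁻ x∈ in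
          subst (_∈ proj₂ (ξ u) a) (sym x≡) (proj₁ (truth⁻ p∈t)))

      π₂-image : ∀ a → proj₂ (ξ v) a ≡ proj₂ (π₂ ⟨$⟩ t) a
      π₂-image a = ⊆-antisym
        (λ y y∈ → let x , x∈ , xRy = backward e a y y∈ in
          truth⁺ (((x , y) , xRy) , truth⁺ (x∈ , y∈) , refl))
        (λ y y∈ → let p , p∈t , y≡ = truth⁻ y∈ in
          subst (_∈ proj₂ (ξ v) a) (sym y≡) (proj₂ (truth⁻ p∈t)))

  -- Compatible operators, their unions and iterates.

  module _ {ξ : Y → M A (𝒫 Y)} where

    -- Carries compatibility from a single operator over to any union containing it.
    Rel-mono : {R S : Relation Y} → R ⊆ S → Rel (M𝒫-functor A) ξ R ⊆ Rel (M𝒫-functor A) ξ S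
    Rel-mono R⊆S _ uv∈ = ∈Rel⁺ {ξ = ξ} record
      { output   = output e
      ; forward  = λ a → matches-map (R⊆S _) (forward e a)
      ; backward = λ a → matches-map (R⊆S _) (backward e a)
      }
      where e = ∈Rel⁻ {ξ = ξ} uv∈

    Tra-compatible : Compatible (M𝒫-functor A) ξ Tra
    Tra-compatible .monotone R S R⊆S _ xz∈ with y , xy∈ , yz∈ ← truth⁻ xz∈ =
      truth⁺ (y , R⊆S _ xy∈ , R⊆S _ yz∈)
    Tra-compatible .compatible R _ xz∈ with y , xy∈ , yz∈ ← truth⁻ xz∈ = ∈Rel⁺ {ξ = ξ} record
      { output   = trans (output e) (output e′)
      ; forward  = λ a → matches-map truth⁺ (matches-∘ (forward e a) (forward e′ a))
      ; backward = λ a → matches-map (λ (v , wv∈ , vu∈) → truth⁺ (v , vu∈ , wv∈))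
          (matches-∘ (backward e′ a) (backward e a))
      }
      where
      e  = ∈Rel⁻ {ξ = ξ} xy∈
      e′ = ∈Rel⁻ {ξ = ξ} yz∈

    Sym-compatible : Compatible (M𝒫-functor A) ξ Sym
    Sym-compatible .monotone R S R⊆S _ yx∈ = truth⁺ (R⊆S _ (truth⁻ yx∈))
    Sym-compatible .compatible R _ yx∈ = ∈Rel⁺ {ξ = ξ} record
      { output   = sym (output e)
      ; forward  = λ a → matches-map truth⁺ (backward e a)
      ; backward = λ a → matches-map truth⁺ (forward e a)
      }
      where e = ∈Rel⁻ {ξ = ξ} (truth⁻ yx∈)

    Rfl-compatible : Compatible (M𝒫-functor A) ξ Rfl
    Rfl-compatible .monotone R S R⊆S _ xy∈ = xy∈
    Rfl-compatible .compatible R (x , y) xy∈ with refl ← truth⁻ xy∈ = ∈Rel⁺ {ξ = ξ} record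
      { output   = refl
      ; forward  = λ a u u∈ → u , u∈ , truth⁺ refl
      ; backward = λ a u u∈ → u , u∈ , truth⁺ refl
      }

    ∪̇-compatible : {f g : Operator Y} → Compatible (M𝒫-functor A) ξ f →
      Compatible (M𝒫-functor A) ξ g → Compatible (M𝒫-functor A) ξ (f ∪̇ g)
    ∪̇-compatible F G .monotone R S R⊆S p =
      truth⁺ ∘ Sum.map (F .monotone R S R⊆S p) (G .monotone R S R⊆S p) ∘ truth⁻
    ∪̇-compatible F G .compatible R p p∈ with truth⁻ p∈
    ... | inj₁ p∈f = Rel-mono (λ _ → truth⁺ ∘ inj₁) p (F .compatible R p p∈f)
    ... | inj₂ p∈g = Rel-mono (λ _ → truth⁺ ∘ inj₂) p (G .compatible R p p∈g)

    fold-compatible : {f : Operator Y} → Compatible (M𝒫-functor A) ξ f →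
      ∀ n → Compatible (M𝒫-functor A) ξ (λ R → fold R f n)
    fold-compatible F zero .monotone R S R⊆S = R⊆S
    fold-compatible F zero .compatible R p p∈ = p∈
    fold-compatible F (suc n) .monotone R S R⊆S =
      F .monotone _ _ (fold-compatible F n .monotone R S R⊆S)
    -- Monotonicity of `f` applies the induction hypothesis under `f`; compatibility of `f` then
    -- moves `Rel` outside.
    fold-compatible F (suc n) .compatible R p =
      F .compatible _ p ∘ F .monotone _ _ (fold-compatible F n .compatible R) p

    ⋃-compatible : {f : I → Operator Y} → (∀ i → Compatible (M𝒫-functor A) ξ (f i)) →
      Compatible (M𝒫-functor A) ξ (λ R → ⋃[ (λ i → f i R) ])
    ⋃-compatible F .monotone R S R⊆S p p∈ with i , p∈fi ← truth⁻ p∈ =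
      truth⁺ (i , F i .monotone R S R⊆S p p∈fi)
    ⋃-compatible F .compatible R p p∈ with i , p∈fi ← truth⁻ p∈ =
      Rel-mono (λ _ q∈ → truth⁺ (i , q∈)) p (F i .compatible R p p∈fi)

  -- Admissible sets over a union.

  restrict : (X → 𝒫 Z) → 𝒫 X → 𝒫 Z → 𝒫 Z
  restrict t S 𝓑 = 𝓑 ∩ compr λ b → ∃ λ x → x ∈ S × b ∈ t x

  -- A witness for `meets` at `x` in `S` lies in `t x`, hence survives the restriction.
  admissible-restrict : {t : X → 𝒫 Z} {S S′ : 𝒫 X} {𝓑 : 𝒫 Z} → S ⊆ S′ →
    Admissible t S′ 𝓑 → Admissible t S (restrict t S 𝓑)
  admissible-restrict S⊆S′ adm .covered b b∈ = truth⁻ (proj₂ (truth⁻ b∈))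
  admissible-restrict S⊆S′ adm .meets x x∈S with b , b∈t , b∈𝓑 ← adm .meets x (S⊆S′ x x∈S) =
    b , b∈t , truth⁺ (b∈𝓑 , truth⁺ (x , x∈S , b∈t))

  -- Both conditions concern one element or one state at a time, so each can be checked inside a
  -- single piece.
  admissible-⋃ : {t : X → 𝒫 Z} {S : I → 𝒫 X} {𝓑 : I → 𝒫 Z} →
    (∀ i → Admissible t (S i) (𝓑 i)) → Admissible t ⋃[ S ] ⋃[ 𝓑 ]
  admissible-⋃ adm .covered b b∈ with i , b∈𝓑i ← truth⁻ b∈
    with x , x∈Si , b∈t ← adm i .covered b b∈𝓑i = x , truth⁺ (i , x∈Si) , b∈t
  admissible-⋃ adm .meets x x∈ with i , x∈Si ← truth⁻ x∈
    with b , b∈t , b∈𝓑i ← adm i .meets x x∈Si = b , b∈t , truth⁺ (i , b∈𝓑i)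

  ⋃-⋃[] : (𝓑 : I → 𝒫 (𝒫 X)) → ⋃ ⋃[ 𝓑 ] ≡ ⋃[ ⋃ ∘ 𝓑 ]
  ⋃-⋃[] 𝓑 = ⊆-antisym
    (λ x x∈ → let U , U∈ , x∈U = truth⁻ x∈; i , U∈𝓑i = truth⁻ U∈ in
      truth⁺ (i , truth⁺ (U , U∈𝓑i , x∈U)))
    (λ x x∈ → let i , x∈⋃ = truth⁻ x∈; U , U∈𝓑i , x∈U = truth⁻ x∈⋃ in
      truth⁺ (U , truth⁺ (i , U∈𝓑i) , x∈U))

  -- By `covered`, an element of `𝓑` lies in some `t x` with `x` in the union, hence in the piece of
  -- any `S i` containing `x`.
  ⋃[restrict] : {t : X → 𝒫 Z} {S : I → 𝒫 X} {𝓑 : 𝒫 Z} → Admissible t ⋃[ S ] 𝓑 →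
    ⋃[ (λ i → restrict t (S i) 𝓑) ] ≡ 𝓑
  ⋃[restrict] adm = ⊆-antisym
    (λ b b∈ → proj₁ (truth⁻ (proj₂ (truth⁻ b∈))))
    (λ b b∈ → let x , x∈ , b∈t = adm .covered b b∈; i , x∈Si = truth⁻ x∈ in
      truth⁺ (i , truth⁺ (b∈ , truth⁺ (x , x∈Si , b∈t))))

  -- The existential of `Ctx` with its index set held fixed. The relation is type-valued, so that a
  -- converse can be passed directly.
  Unions : (I : Set) → (𝒫 X → 𝒫 X → Set) → 𝒫 X → 𝒫 X → Set
  Unions {X} I _~_ P Q = ∃₂ λ (U V : I → 𝒫 X) → (∀ i → U i ~ V i) × P ≡ ⋃[ U ] × Q ≡ ⋃[ V ]

  -- The determinization on unions of state sets.

  module _ {A X : Set} (c : X → M A (𝒫 (𝒫 X))) where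

    -- The members of the iterated image are exactly the `t x` with `x` in `S`, so quantifying over
    -- them amounts to quantifying over `S`.
    δ⇔admissible : ∀ a S {𝓑} →
      𝓑 ∈ δ (𝒫 X) (image (λ s → proj₂ s a) (image c S)) ⇔ Admissible (λ x → proj₂ (c x) a) S 𝓑
    δ⇔admissible a S {𝓑} = mk⇔ toAdm fromAdm
      where
      t : X → 𝒫 (𝒫 X)
      t x = proj₂ (c x) a

      𝒜 : 𝒫 (𝒫 (𝒫 X))
      𝒜 = image (λ s → proj₂ s a) (image c S)

      ∈𝒜⁺ : ∀ {x} → x ∈ S → t x ∈ 𝒜
      ∈𝒜⁺ {x} x∈S = truth⁺ (c x , truth⁺ (x , x∈S , refl) , refl)

      ∈𝒜⁻ : ∀ {𝒯} → 𝒯 ∈ 𝒜 → ∃ λ x → x ∈ S × 𝒯 ≡ t x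
      ∈𝒜⁻ 𝒯∈ with s , s∈ , 𝒯≡ ← truth⁻ 𝒯∈ with x , x∈S , s≡ ← truth⁻ s∈ =
        x , x∈S , trans 𝒯≡ (cong (λ s → proj₂ s a) s≡)

      toAdm : 𝓑 ∈ δ (𝒫 X) 𝒜 → Admissible t S 𝓑
      toAdm 𝓑∈ .covered b b∈ =
        let 𝒯 , 𝒯∈ , b∈𝒯 = truth⁻ (proj₁ (truth⁻ 𝓑∈) b b∈)
            x , x∈S , 𝒯≡ = ∈𝒜⁻ 𝒯∈
        in x , x∈S , subst (b ∈_) 𝒯≡ b∈𝒯
      toAdm 𝓑∈ .meets x x∈S = ∩≢∅⇔ .to (proj₂ (truth⁻ 𝓑∈) (t x) (∈𝒜⁺ x∈S))

      fromAdm : Admissible t S 𝓑 → 𝓑 ∈ δ (𝒫 X) 𝒜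
      fromAdm adm = truth⁺
        ( (λ b b∈ → let x , x∈S , b∈t = adm .covered b b∈ in truth⁺ (t x , ∈𝒜⁺ x∈S , b∈t))
        , (λ 𝒯 𝒯∈ → let x , x∈S , 𝒯≡ = ∈𝒜⁻ 𝒯∈ in
            subst (λ 𝒯 → 𝒯 ∩ 𝓑 ≢ ∅) (sym 𝒯≡) (∩≢∅⇔ .from (adm .meets x x∈S))) )

    successors⇔admissible : ∀ a S {P} → P ∈ proj₂ (determinize c S) a ⇔
      (∃ λ 𝓑 → Admissible (λ x → proj₂ (c x) a) S 𝓑 × P ≡ ⋃ 𝓑)
    successors⇔admissible a S {P} = mk⇔
      (λ (P∈ : P ∈ proj₂ (determinize c S) a) → let 𝓑 , 𝓑∈ , P≡ = truth⁻ P∈ in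
        𝓑 , δ⇔admissible a S .to 𝓑∈ , P≡)
      (λ (𝓑 , adm , P≡) → truth⁺ (𝓑 , δ⇔admissible a S .from adm , P≡))

    output⇔ : ∀ {S} → T (proj₁ (determinize c S)) ⇔ (∀ x → x ∈ S → T (proj₁ (c x)))
    output⇔ {S} = mk⇔
      (λ o x x∈S → T-≡ .from (truth⁻ o (c x) (truth⁺ (x , x∈S , refl))))
      (λ h → truth⁺ λ s s∈ → let x , x∈S , s≡ = truth⁻ {P = ∃ λ x → x ∈ S × s ≡ c x} s∈ in
        trans (cong proj₁ s≡) (T-≡ .to (h x x∈S)))

    -- The output is a conjunction over states, so over a union it splits into the conjunctions over
    -- the pieces.
    output-⋃ : {S : I → 𝒫 X} →
      T (proj₁ (determinize c ⋃[ S ])) ⇔ (∀ i → T (proj₁ (determinize c (S i))))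
    output-⋃ {S = S} = mk⇔
      (λ o i → output⇔ .from λ x x∈Si → output⇔ .to o x (truth⁺ (i , x∈Si)))
      (λ h → output⇔ {⋃[ S ]} .from λ x x∈ → let i , x∈Si = truth⁻ x∈ in output⇔ .to (h i) x x∈Si)

    -- One half of the lifting suffices: the other is the same result for the converse relation with
    -- `U` and `V` exchanged.
    matches-⋃ : {_~_ : 𝒫 X → 𝒫 X → Set} {U V : I → 𝒫 X} (a : A) →
      (∀ i → Matches _~_ (proj₂ (determinize c (U i)) a) (proj₂ (determinize c (V i)) a)) →
      Matches (Unions I _~_) (proj₂ (determinize c ⋃[ U ]) a) (proj₂ (determinize c ⋃[ V ]) a)
    matches-⋃ {I = I} {_~_ = _~_} {U} {V} a m P P∈
      with 𝓑 , 𝓑-adm , P≡ ← successors⇔admissible a ⋃[ U ] .to P∈ =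
      ⋃ ⋃[ 𝓒 ] ,
      successors⇔admissible a ⋃[ V ] .from (⋃[ 𝓒 ] , admissible-⋃ 𝓒-adm , refl) ,
      ⋃ ∘ 𝓑′ , ⋃ ∘ 𝓒 , ~𝓒 ,
      -- The restrictions together recover all of `𝓑`, so `P` is the union over `i` of the sets
      -- `⋃ (𝓑′ i)`.
      trans P≡ (trans (cong ⋃ (sym (⋃[restrict] 𝓑-adm))) (⋃-⋃[] 𝓑′)) ,
      ⋃-⋃[] 𝓒
      where
      t : X → 𝒫 (𝒫 X)
      t x = proj₂ (c x) a

      𝓑′ : I → 𝒫 (𝒫 X)
      𝓑′ i = restrict t (U i) 𝓑

      match : ∀ i → ∃ λ 𝓒 → Admissible t (V i) 𝓒 × ⋃ (𝓑′ i) ~ ⋃ 𝓒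
      match i =
        let Q , Q∈ , ~Q = m i (⋃ (𝓑′ i)) (successors⇔admissible a (U i) .from
              (𝓑′ i , admissible-restrict (λ x x∈ → truth⁺ (i , x∈)) 𝓑-adm , refl))
            𝓒 , 𝓒-adm , Q≡ = successors⇔admissible a (V i) .to Q∈
        in 𝓒 , 𝓒-adm , subst (⋃ (𝓑′ i) ~_) Q≡ ~Q

      𝓒 : I → 𝒫 (𝒫 X)
      𝓒 i = proj₁ (match i)

      𝓒-adm : ∀ i → Admissible t (V i) (𝓒 i)
      𝓒-adm i = proj₁ (proj₂ (match i))

      ~𝓒 : ∀ i → ⋃ (𝓑′ i) ~ ⋃ (𝓒 i)
      ~𝓒 i = proj₂ (proj₂ (match i))

    Ctx-compatible : Compatible (M𝒫-functor A) (determinize c) Ctx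
    Ctx-compatible .monotone R S R⊆S _ p∈ with I , U , V , UV∈R , p≡ ← truth⁻ p∈ =
      truth⁺ (I , U , V , (λ i → R⊆S _ (UV∈R i)) , p≡)
    Ctx-compatible .compatible R (_ , _) p∈ with I , U , V , UV∈Rel , refl ← truth⁻ p∈ =
      ∈Rel⁺ {ξ = determinize c} record
        { output   = T-injective
            (λ o → output-⋃ .from λ i → subst T (output (e i)) (output-⋃ .to o i))
            (λ o → output-⋃ .from λ i → subst T (sym (output (e i))) (output-⋃ .to o i))
        ; forward  = λ a → matches-map
            (λ (P , Q , PQ∈R , u≡ , v≡) → truth⁺ (I , P , Q , PQ∈R , cong₂ _,_ u≡ v≡))
            (matches-⋃ a λ i → forward (e i) a)
        ; backward = λ a → matches-map
            (λ (Q , P , PQ∈R , v≡ , u≡) → truth⁺ (I , P , Q , PQ∈R , cong₂ _,_ u≡ v≡))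
            (matches-⋃ a λ i → backward (e i) a)
        }
      where
      e : ∀ i → EgliMilner [ R ] (determinize c (U i)) (determinize c (V i))
      e i = ∈Rel⁻ {ξ = determinize c} (UV∈Rel i)

    Cgr-compatible : Compatible (M𝒫-functor A) (determinize c) Cgr
    Cgr-compatible = ⋃-compatible (fold-compatible
      (∪̇-compatible Tra-compatible (∪̇-compatible Sym-compatible
        (∪̇-compatible Ctx-compatible Rfl-compatible))))

proposition24 : (em : ∀ {ℓ} → ExcludedMiddle ℓ) →
    Extensionality 0ℓ 0ℓ →
    let open Classical em in
    (A : Set) (n : ℕ) → A ↔ Fin n →
    (X : Set) (c : X → M A (𝒫 (𝒫 X))) →
    Compatible (M𝒫-functor A) (determinize c) Ctx ×
    Compatible (M𝒫-functor A) (determinize c) Cgr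
proposition24 em ext A n A↔Fin X c = Ctx-compatible em ext c , Cgr-compatible em ext c
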